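{- Let $F_n$ be a $2$-regular graph with $n$ vertices. Then $F_n$ is potentially triangulable in the convex complete graph $K_n$ if and only if $F_n$ is not isomorphic to any of $C_3, C_4, C_5, C_6, C_3\cup C_3, C_3\cup C_4$ (where $C_k$ is the $k$-cycle and $\cup$ denotes disjoint union).
   Context: A convex complete graph $K_n$ is the complete graph on $n$ points in convex position in the plane, edges drawn as straight-line segments. For a subgraph $F$ of $K_n$, $K_n-F$ is obtained by deleting the edges of $F$ (all vertices kept). A convex graph on $n$ vertices admits a triangulation if it contains all $n$ boundary edges (edges between vertices consecutive along the convex hull boundary) and $n-3$ pairwise non-crossing diagonals. A graph $F$ with $n$ vertices is potentially triangulable in $K_n$ if there is a bijective placement of its vertices on the vertices of $K_n$ (edges becoming the corresponding edges of $K_n$) such that $K_n-F$ admits a triangulation. -}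

module Defs where

open import Data.Nat using (ℕ; zero; suc; _<_; _∸_; _≡ᵇ_; _+_)
open import Data.Bool using (Bool; true; false; _∨_; _∧_; if_then_else_)
open import Data.Fin using (Fin; toℕ; splitAt)
open import Data.List using (List; length; map; allFin)
open import Data.Nat.ListAction using (sum)
open import Data.List.Relation.Unary.All using (All)
open import Data.List.Relation.Unary.AllPairs using (AllPairs)
open import Data.Product using (Σ; _×_; _,_; ∃)
open import Data.Sum using (_⊎_; inj₁; inj₂)
open import Function.Bundles using (_↔_; Inverse)
open import Relation.Binary.PropositionalEquality using (_≡_; _≢_)
open import Relation.Nullary using (¬_)

Graph : ℕ → Set
Graph n = Fin n → Fin n → Bool

Symmetric : ∀ {n} → Graph n → Set
Symmetric {n} G = ∀ (a b : Fin n) → G a b ≡ G b a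

Loopless : ∀ {n} → Graph n → Set
Loopless {n} G = ∀ (a : Fin n) → G a a ≡ false

deg : ∀ {n} → Graph n → Fin n → ℕ
deg {n} G i = sum (map (λ j → if G i j then 1 else 0) (allFin n))

TwoRegular : ∀ {n} → Graph n → Set
TwoRegular {n} G = ∀ (i : Fin n) → deg G i ≡ 2

Iso : ∀ {m n} → Graph m → Graph n → Set
Iso {m} {n} G H = Σ (Fin m ↔ Fin n) λ f →
  ∀ (a b : Fin m) → H (Inverse.to f a) (Inverse.to f b) ≡ G a b

cycAdj : ℕ → ℕ → ℕ → Bool
cycAdj k a b = (suc a ≡ᵇ b) ∨ (suc b ≡ᵇ a) ∨ ((a ≡ᵇ 0) ∧ (suc b ≡ᵇ k)) ∨ ((b ≡ᵇ 0) ∧ (suc a ≡ᵇ k))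

C : (k : ℕ) → Graph k
C k i j = cycAdj k (toℕ i) (toℕ j)

infixl 6 _∪ᴳ_
_∪ᴳ_ : ∀ {m n} → Graph m → Graph n → Graph (m + n)
_∪ᴳ_ {m} {n} G H a b with splitAt m a | splitAt m b
... | inj₁ x | inj₁ y = G x y
... | inj₂ x | inj₂ y = H x y
... | inj₁ _ | inj₂ _ = false
... | inj₂ _ | inj₁ _ = false

-- Convex position: vertices of K_n are 0,…,n-1 in cyclic order along the hull.
-- For a < b, the segment ab is a boundary edge iff b = a+1 or (a = 0 and b = n-1).
BoundaryPair : (n : ℕ) → ℕ → ℕ → Set
BoundaryPair n a b = (suc a ≡ b) ⊎ ((a ≡ 0) × (suc b ≡ n))

IsDiagonal : (n : ℕ) → Fin n × Fin n → Set
IsDiagonal n (a , b) = (toℕ a < toℕ b) × ¬ BoundaryPair n (toℕ a) (toℕ b)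

-- Two segments (a,b), (c,d) with a<b, c<d between convex-position points cross
-- (in their relative interiors) iff their endpoints strictly interleave.
Cross : ∀ {n} → Fin n × Fin n → Fin n × Fin n → Set
Cross (a , b) (c , d) =
  (toℕ a < toℕ c × toℕ c < toℕ b × toℕ b < toℕ d) ⊎
  (toℕ c < toℕ a × toℕ a < toℕ d × toℕ d < toℕ b)

AdmitsTriangulation : ∀ {n} → Graph n → Set
AdmitsTriangulation {n} G =
  (∀ (a b : Fin n) → toℕ a < toℕ b → BoundaryPair n (toℕ a) (toℕ b) → G a b ≡ true) ×
  ∃ λ (D : List (Fin n × Fin n)) →
      (length D ≡ n ∸ 3) ×
      All (λ d → IsDiagonal n d × G (Data.Product.proj₁ d) (Data.Product.proj₂ d) ≡ true) D ×
      AllPairs (λ d e → (d ≢ e) × ¬ Cross d e) D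

-- K_n - F where the vertex of F placed at hull position p is π p (π a bijection).
KminusPlaced : ∀ {n} → Graph n → (Fin n ↔ Fin n) → Graph n
KminusPlaced F π a b = if F (Inverse.to π a) (Inverse.to π b) then false else true

-- Potentially triangulable: some bijective placement makes K_n - F admit a triangulation.
-- (K_n - F keeps only the non-loop pairs; loops never occur in the conditions above.)
PotentiallyTriangulable : ∀ {n} → Graph n → Set
PotentiallyTriangulable {n} F = ∃ λ (π : Fin n ↔ Fin n) → AdmitsTriangulation (KminusPlaced F π)

{-# OPTIONS --safe #-}
-- In the zigzag triangulation, listing the vertices along the zigzag numbers them so that
-- the edges of the triangulation are exactly the pairs at distance 1 or 2.  Hence it
-- suffices to number the vertices of F injectively by 0,…,n-1 so that adjacent vertices
-- are at distance at least 3.  A k-cycle with k ≥ 7 can be numbered by alternating between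
-- the lower and the upper half.  A further cycle can be squeezed into any numbering of at
-- least four vertices, since moving old labels apart does no harm.  This leaves finitely
-- many unions of short cycles, numbered explicitly.  The six exceptional graphs are
-- refuted by exhaustive search over Hamiltonian cycles of the complement.
module Submission where

open import Defs
open import Data.Nat using (ℕ)
open import Data.Sum using (_⊎_)
open import Function.Bundles using (_⇔_)
open import Relation.Nullary using (¬_)

open import Data.Bool using (Bool; T; true; false; if_then_else_; _∧_)
import Data.Bool.Properties as Bool
open import Data.Empty using (⊥; ⊥-elim)
open import Data.Fin using (Fin; zero; suc; toℕ; fromℕ<; punchOut)
open import Data.Fin.Permutation using (↔⇒≡)
import Data.Fin.Properties as Fin
open import Data.Fin.Properties using (all?; any?; toℕ-injective; toℕ<n; toℕ-fromℕ<; +↔⊎; ¬∀⟶∃¬; injective⇒≤; punchOut-injective)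
open import Data.List using (List; []; _∷_; length; map; allFin; tabulate; concatMap; filter; cartesianProduct)
import Data.List.Properties as List
open import Data.List.Membership.Propositional using (_∈_; lose)
open import Data.List.Membership.Propositional.Properties using (∈-allFin; ∈-filter⁺; ∈-concatMap⁺; ∈-cartesianProduct⁺; ∈-map⁺)
open import Data.List.Relation.Unary.All as All using (All; []; _∷_)
import Data.List.Relation.Unary.All.Properties as All
open import Data.List.Relation.Unary.AllPairs using (AllPairs; []; _∷_)
import Data.List.Relation.Unary.AllPairs.Properties as AllPairs
import Data.List.Relation.Unary.Any as Any
open import Data.List.Relation.Unary.Any using (Any; here; there)
open import Data.List.Relation.Unary.Unique.Propositional using (Unique)
open import Data.List.Relation.Unary.Unique.Propositional.Properties using (allFin⁺)
open import Data.Nat hiding (ℕ)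
open import Data.Nat.ListAction using (sum)
open import Data.Nat.Properties
open import Data.Product using (Σ; _×_; _,_; ∃; proj₁; proj₂)
open import Data.Product.Properties using (≡-dec)
import Data.Sum as Sum
open import Data.Sum using (inj₁; inj₂; [_,_]; [_,_]′)
open import Data.Sum.Function.Propositional using (_⊎-↔_)
import Data.Sum.Properties as Sum
open import Data.Unit using (⊤; tt)
open import Data.Vec as Vec using (Vec; []; _∷_; lookup)
import Data.Vec.Properties as Vec
import Data.Vec.Relation.Unary.All as VAll
import Data.Vec.Relation.Unary.All.Properties as VAll
open import Function using (_∘_)
open import Function.Bundles using (_↔_; Inverse; mk↔ₛ′; mk⇔; Equivalence)
open import Function.Definitions using (Injective)
open import Function.Properties.Inverse using (↔-refl; ↔-sym; ↔-trans)
open import Relation.Binary.Definitions using (tri<; tri≈; tri>)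
open import Relation.Binary.PropositionalEquality hiding ([_])
open import Relation.Nullary using (Dec; yes; no; contradiction; ¬?)
open import Relation.Nullary.Decidable using (map′; toWitness; True; _→-dec_; _×-dec_; _⊎-dec_)

-- Labellings that keep adjacent vertices at distance at least three

injective⇒↔ : ∀ {n} (f : Fin n → Fin n) → Injective _≡_ _≡_ f →
  Σ (Fin n ↔ Fin n) λ g → ∀ x → Inverse.to g x ≡ f x
injective⇒↔ {zero} f inj = ↔-refl , λ ()
injective⇒↔ {suc n} f inj =
  mk↔ₛ′ f (proj₁ ∘ preimage) (proj₂ ∘ preimage)
    (λ x → inj (proj₂ (preimage (f x)))) , λ _ → refl
  where
  preimage : ∀ y → ∃ λ x → f x ≡ y
  preimage y with any? (λ x → f x Fin.≟ y)
  ... | yes p = p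
  -- Pigeonhole: a value `y` missed by `f` could be punched out of the codomain, which would inject
  -- `Fin (suc n)` into `Fin n`.
  ... | no ∄ = contradiction
    (injective⇒≤ {f = λ x → punchOut (y≢f x)} (inj ∘ punchOut-injective (y≢f _) (y≢f _)))
    1+n≰n
    where
    y≢f : ∀ x → y ≢ f x
    y≢f x eq = ∄ (x , sym eq)

Far : ℕ → ℕ → Set
Far a b = (3 + a ≤ b) ⊎ (3 + b ≤ a)

far-sym : ∀ {a b} → Far a b → Far b a
far-sym = Sum.swap

far-suc : ∀ {a b} → Far a b → Far (suc a) (suc b)
far-suc = Sum.map s≤s s≤s

far-pred : ∀ {a b} → Far (suc a) (suc b) → Far a b
far-pred = Sum.map s≤s⁻¹ s≤s⁻¹

far? : ∀ a b → Dec (Far a b)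
far? a b = (3 + a ≤? b) ⊎-dec (3 + b ≤? a)

-- When `N` is the number of vertices, this packs `adj` into the complement of the square of a path:
-- pairs of labels at distance 1 or 2 stay free for the triangulation.
record Spread {X : Set} (adj : X → X → Bool) (N : ℕ) : Set where
  field
    label     : X → ℕ
    injective : ∀ {x y} → label x ≡ label y → x ≡ y
    bounded   : ∀ x → label x < N
    far       : ∀ x y → adj x y ≡ true → Far (label x) (label y)

-- The zigzag triangulation

-- Labels along the hull for which the zigzag triangulation consists of the pairs
-- of labels at distance 1 or 2; q is the number of positions after p.
zigzag : ℕ → ℕ → ℕ
zigzag zero    q       = 0
zigzag (suc p) zero    = 1
zigzag (suc p) (suc q) = 2 + zigzag p q

zigzag≤ : ∀ p q → zigzag p q ≤ p + q
zigzag≤ zero    q       = z≤n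
zigzag≤ (suc p) zero    = s≤s z≤n
zigzag≤ (suc p) (suc q) = s≤s (subst (suc (zigzag p q) ≤_) (sym (+-suc p q)) (s≤s (zigzag≤ p q)))

zigzag-injective : ∀ p q p′ q′ → p + q ≡ p′ + q′ → zigzag p q ≡ zigzag p′ q′ → p ≡ p′
zigzag-injective zero    q       zero     q′       _ _ = refl
zigzag-injective zero    q       (suc p′) zero     _ ()
zigzag-injective zero    q       (suc p′) (suc q′) _ ()
zigzag-injective (suc p) zero    zero     q′       _ ()
zigzag-injective (suc p) (suc q) zero     q′       _ ()
zigzag-injective (suc p) zero    (suc p′) zero     e _ = +-cancelʳ-≡ 0 (suc p) (suc p′) e
zigzag-injective (suc p) zero    (suc p′) (suc q′) _ ()
zigzag-injective (suc p) (suc q) (suc p′) zero     _ ()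
zigzag-injective (suc p) (suc q) (suc p′) (suc q′) e l =
  cong suc (zigzag-injective p q p′ q′
    (suc-injective (trans (sym (+-suc p q)) (trans (suc-injective e) (+-suc p′ q′))))
    (suc-injective (suc-injective l)))

-- Removing one position at each end of the hull lowers both labels by 2, so only pairs touching an
-- end have to be inspected.
zigzag-consecutive : ∀ p q → ¬ Far (zigzag p (suc q)) (zigzag (suc p) q)
zigzag-consecutive zero          zero    (inj₁ (s≤s ()))
zigzag-consecutive zero          zero    (inj₂ ())
zigzag-consecutive zero          (suc q) (inj₁ (s≤s (s≤s ())))
zigzag-consecutive zero          (suc q) (inj₂ ())
zigzag-consecutive (suc zero)    zero    (inj₁ (s≤s ()))
zigzag-consecutive (suc zero)    zero    (inj₂ (s≤s (s≤s ())))
zigzag-consecutive (suc (suc p)) zero    (inj₁ (s≤s ()))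
zigzag-consecutive (suc (suc p)) zero    (inj₂ (s≤s (s≤s (s≤s ()))))
zigzag-consecutive (suc p)       (suc q) f =
  zigzag-consecutive p q (far-pred (far-pred f))

-- Along the hull the labels read 0, 2, 4, ..., 5, 3, 1: the first half carries the even labels and
-- the second half the odd ones.
zigzag-left : ∀ {p q} → p ≤ q → zigzag p q ≡ p + p
zigzag-left {zero}          _         = refl
zigzag-left {suc p} {suc q} (s≤s p≤q) = cong suc (trans (cong suc (zigzag-left p≤q)) (sym (+-suc p p)))

zigzag-right : ∀ {p q} → q < p → zigzag p q ≡ suc (q + q)
zigzag-right {suc p} {zero}  _         = refl
zigzag-right {suc p} {suc q} (s≤s q<p) =
  cong suc (trans (cong suc (zigzag-right q<p)) (cong suc (sym (+-suc q q))))

⌈n/2⌉-cases : ∀ n → ⌈ n /2⌉ ≡ ⌊ n /2⌋ ⊎ ⌈ n /2⌉ ≡ suc ⌊ n /2⌋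
⌈n/2⌉-cases zero          = inj₁ refl
⌈n/2⌉-cases (suc zero)    = inj₂ refl
⌈n/2⌉-cases (suc (suc n)) = Sum.map (cong suc) (cong suc) (⌈n/2⌉-cases n)

module Zigzag {n : ℕ} (F : Graph n) (S : Spread F n) where
  open Spread S

  after : Fin n → ℕ
  after p = n ∸ suc (toℕ p)

  position+after : ∀ p → suc (toℕ p + after p) ≡ n
  position+after p = m+[n∸m]≡n (toℕ<n p)

  hull : Fin n → ℕ
  hull p = zigzag (toℕ p) (after p)

  hull-bounded : ∀ p → hull p < n
  hull-bounded p = subst (suc (hull p) ≤_) (position+after p) (s≤s (zigzag≤ (toℕ p) (after p)))

  hull-injective : ∀ {p q} → hull p ≡ hull q → p ≡ q
  hull-injective {p} {q} eq = toℕ-injective (zigzag-injective _ (after p) _ (after q)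
    (suc-injective (trans (position+after p) (sym (position+after q)))) eq)

  labels hulls : Σ (Fin n ↔ Fin n) _
  labels = injective⇒↔ (λ v → fromℕ< (bounded v))
    (λ eq → injective (Fin.fromℕ<-injective _ _ _ _ eq))
  hulls = injective⇒↔ (λ p → fromℕ< (hull-bounded p))
    (λ eq → hull-injective (Fin.fromℕ<-injective _ _ _ _ eq))

  placement : Fin n ↔ Fin n
  placement = ↔-trans (proj₁ hulls) (↔-sym (proj₁ labels))

  label-placement : ∀ p → label (Inverse.to placement p) ≡ hull p
  label-placement p = begin
    label (Inverse.to placement p)                               ≡⟨ toℕ-fromℕ< _ ⟨
    toℕ (fromℕ< (bounded (Inverse.to placement p)))              ≡⟨ cong toℕ (proj₂ labels _) ⟨
    toℕ (Inverse.to (proj₁ labels) (Inverse.to placement p))     ≡⟨ cong toℕ (Inverse.strictlyInverseˡ (proj₁ labels) _) ⟩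
    toℕ (Inverse.to (proj₁ hulls) p)                             ≡⟨ cong toℕ (proj₂ hulls p) ⟩
    toℕ (fromℕ< (hull-bounded p))                                ≡⟨ toℕ-fromℕ< _ ⟩
    hull p                                                       ∎
    where open ≡-Reasoning

  near⇒kept : ∀ a b → ¬ Far (hull a) (hull b) → KminusPlaced F placement a b ≡ true
  near⇒kept a b near with F (Inverse.to placement a) (Inverse.to placement b) in eq
  ... | false = refl
  ... | true  = contradiction
    (subst₂ Far (label-placement a) (label-placement b) (far _ _ eq)) near

  boundary-near : ∀ a b → toℕ a < toℕ b → BoundaryPair n (toℕ a) (toℕ b) → ¬ Far (hull a) (hull b)
  boundary-near a b _ (inj₁ 1+a≡b) =
    subst₂ (λ x y → ¬ Far (zigzag (toℕ a) x) (zigzag y (after b))) 1+after≡after 1+a≡b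
      (zigzag-consecutive (toℕ a) (after b))
    where
    1+after≡after : suc (after b) ≡ after a
    1+after≡after = +-cancelˡ-≡ (toℕ a) _ _ (suc-injective (begin
      suc (toℕ a + suc (after b)) ≡⟨ cong suc (+-suc (toℕ a) (after b)) ⟩
      suc (suc (toℕ a) + after b) ≡⟨ cong (λ x → suc (x + after b)) 1+a≡b ⟩
      suc (toℕ b + after b)       ≡⟨ position+after b ⟩
      n                           ≡⟨ position+after a ⟨
      suc (toℕ a + after a)       ∎))
      where open ≡-Reasoning
  boundary-near a b a<b (inj₂ (a≡0 , 1+b≡n)) =
    -- The closing hull edge joins the first and the last position, whose labels are 0 and 1.
    subst₂ (λ x y → ¬ Far (zigzag x (after a)) y) (sym a≡0)
      (sym (trans (cong (zigzag (toℕ b)) after≡0) (zigzag-right (≤-trans (s≤s z≤n) a<b))))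
      λ { (inj₁ (s≤s ())) ; (inj₂ ()) }
    where
    after≡0 : after b ≡ 0
    after≡0 = trans (cong (n ∸_) 1+b≡n) (n∸n≡0 n)

  module Diagonal (i : ℕ) (i<n∸3 : i < n ∸ 3) where
    -- The `i`-th diagonal joins the labels `i + 1` and `i + 2`. Position `suc c` carries the even
    -- one, `2c + 2`, and position `n ∸ suc d` the odd one, `2d + 1`. All other pairs of labels at
    -- distance 1 or 2 are hull edges.
    c d : ℕ
    c = ⌊ i /2⌋
    d = ⌈ i /2⌉

    c+d≡i : c + d ≡ i
    c+d≡i = ⌊n/2⌋+⌈n/2⌉≡n i

    c≤d : c ≤ d
    c≤d = ⌊n/2⌋≤⌈n/2⌉ i

    d≤1+c : d ≤ suc c
    d≤1+c = [ (λ e → ≤-trans (≤-reflexive e) (n≤1+n c)) , ≤-reflexive ]′ (⌈n/2⌉-cases i)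

    4+c+d≤n : 4 + (c + d) ≤ n
    4+c+d≤n = subst₂ _≤_ (trans (+-comm (suc i) 3) (cong (4 +_) (sym c+d≡i))) refl
      -- Since `n ∸ 3` exceeds `i` it is nonzero, so the subtraction is not truncated and can be
      -- undone.
      (m≤o∸n⇒m+n≤o (suc i) (<⇒≤ (m∸n≢0⇒n<m λ e → m<n⇒n≢0 i<n∸3 e)) i<n∸3)

    left<n : suc c < n
    left<n = ≤-trans (s≤s (s≤s (≤-trans (m≤m+n c d) (m≤n+m _ 2)))) 4+c+d≤n

    1+d≤n : suc d ≤ n
    1+d≤n = ≤-trans (s≤s (≤-trans (m≤n+m d c) (m≤n+m _ 3))) 4+c+d≤n

    right<n : n ∸ suc d < n
    right<n = ∸-monoʳ-< {n} {suc d} {0} (s≤s z≤n) 1+d≤n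

    left right : Fin n
    left  = fromℕ< left<n
    right = fromℕ< right<n

    left≡ : toℕ left ≡ suc c
    left≡ = toℕ-fromℕ< left<n

    right≡ : toℕ right ≡ n ∸ suc d
    right≡ = toℕ-fromℕ< right<n

    gap : 3 + c ≤ n ∸ suc d
    gap = m+n≤o⇒m≤o∸n (3 + c) (subst (_≤ n) (cong (3 +_) (sym (+-suc c d))) 4+c+d≤n)

    isDiagonal : IsDiagonal n (left , right)
    isDiagonal rewrite left≡ | right≡ =
      <⇒≤ gap , λ { (inj₁ e) → <⇒≢ gap e ; (inj₂ (() , _)) }

    hull-left : hull left ≡ suc c + suc c
    hull-left rewrite left≡ = zigzag-left (m+n≤o⇒m≤o∸n (suc c)
      (≤-trans (s≤s (≤-trans (≤-reflexive (trans (+-suc c (suc c)) (cong suc (+-suc c c))))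
          (s≤s (s≤s (+-monoʳ-≤ c c≤d)))))
        (≤-trans (n≤1+n _) 4+c+d≤n)))

    hull-right : hull right ≡ suc (d + d)
    hull-right rewrite right≡ =
      trans (cong (zigzag (n ∸ suc d)) after≡) (zigzag-right (m+n≤o⇒m≤o∸n (suc d)
        (≤-trans (s≤s (≤-trans (+-monoˡ-≤ (suc d) d≤1+c) (≤-reflexive (cong suc (+-suc c d)))))
          (≤-trans (n≤1+n _) 4+c+d≤n))))
      where
      after≡ : n ∸ suc (n ∸ suc d) ≡ d
      after≡ = trans (cong (n ∸_) (sym (+-∸-assoc 1 1+d≤n))) (m∸[m∸n]≡n (<⇒≤ 1+d≤n))

    near : ¬ Far (hull left) (hull right)
    near rewrite hull-left | hull-right | +-suc c c with ⌈n/2⌉-cases i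
    ... | inj₁ e rewrite e = λ
      { (inj₁ h) → m+n≮n 3 (c + c) (s≤s⁻¹ h)
      ; (inj₂ h) → m+n≮n 1 (c + c) (s≤s⁻¹ (s≤s⁻¹ h)) }
    ... | inj₂ e rewrite e | +-suc c c = λ
      { (inj₁ h) → m+n≮n 1 (c + c) (s≤s⁻¹ (s≤s⁻¹ (s≤s⁻¹ h)))
      ; (inj₂ h) → m+n≮n 3 (c + c) (s≤s⁻¹ (s≤s⁻¹ h)) }

  diagonal : Fin (n ∸ 3) → Fin n × Fin n
  diagonal i = Diagonal.left (toℕ i) (toℕ<n i) , Diagonal.right (toℕ i) (toℕ<n i)

  -- As the index grows, left ends never move left and right ends never move right, so the diagonals
  -- are nested and cannot interleave. The ends determine `c` and `d`, and hence the index `c + d`.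
  diagonal-compatible : ∀ {i j} → toℕ i < toℕ j →
    diagonal i ≢ diagonal j × ¬ Cross (diagonal i) (diagonal j)
  diagonal-compatible {i} {j} i<j = distinct , noncrossing
    where
    module I = Diagonal (toℕ i) (toℕ<n i)
    module J = Diagonal (toℕ j) (toℕ<n j)

    lefts : toℕ I.left ≤ toℕ J.left
    lefts rewrite I.left≡ | J.left≡ = s≤s (⌊n/2⌋-mono (<⇒≤ i<j))

    rights : toℕ J.right ≤ toℕ I.right
    rights rewrite I.right≡ | J.right≡ = ∸-monoʳ-≤ n (s≤s (⌈n/2⌉-mono (<⇒≤ i<j)))

    distinct : diagonal i ≢ diagonal j
    distinct e = <⇒≢ i<j (begin
      toℕ i       ≡⟨ I.c+d≡i ⟨
      I.c + I.d   ≡⟨ cong₂ _+_ c≡ d≡ ⟩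
      J.c + J.d   ≡⟨ J.c+d≡i ⟩
      toℕ j       ∎)
      where
      open ≡-Reasoning
      c≡ : I.c ≡ J.c
      c≡ = suc-injective (trans (sym I.left≡) (trans (cong (toℕ ∘ proj₁) e) J.left≡))
      d≡ : I.d ≡ J.d
      d≡ = suc-injective (∸-cancelˡ-≡ I.1+d≤n J.1+d≤n
        (trans (sym I.right≡) (trans (cong (toℕ ∘ proj₂) e) J.right≡)))

    noncrossing : ¬ Cross (diagonal i) (diagonal j)
    noncrossing (inj₁ (_ , _ , r<r)) = <⇒≱ r<r rights
    noncrossing (inj₂ (l<l , _))     = <⇒≱ l<l lefts

  potentiallyTriangulable : PotentiallyTriangulable F
  potentiallyTriangulable =
    placement ,
    (λ a b a<b bd → near⇒kept a b (boundary-near a b a<b bd)) ,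
    tabulate diagonal ,
    List.length-tabulate diagonal ,
    All.tabulate⁺ (λ i → Diagonal.isDiagonal (toℕ i) (toℕ<n i) ,
                         near⇒kept _ _ (Diagonal.near (toℕ i) (toℕ<n i))) ,
    AllPairs.tabulate⁺-< diagonal-compatible

-- Numberings of disjoint unions of cycles

_⊕_ : ∀ {X Y : Set} → (X → X → Bool) → (Y → Y → Bool) → X ⊎ Y → X ⊎ Y → Bool
(f ⊕ g) (inj₁ x) (inj₁ y) = f x y
(f ⊕ g) (inj₁ x) (inj₂ y) = false
(f ⊕ g) (inj₂ x) (inj₁ y) = false
(f ⊕ g) (inj₂ x) (inj₂ y) = g x y

-- Nested sums rather than `Fin (sum ks)`, so that the cycle containing a vertex is found by pattern
-- matching. `enumeration` recovers the finite index set for decision procedures.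
Vertex : List ℕ → Set
Vertex []       = ⊥
Vertex (k ∷ ks) = Fin k ⊎ Vertex ks

cycles : ∀ ks → Vertex ks → Vertex ks → Bool
cycles []       ()
cycles (k ∷ ks) = C k ⊕ cycles ks

enumeration : ∀ ks → Fin (sum ks) ↔ Vertex ks
enumeration []       = mk↔ₛ′ (λ ()) (λ ()) (λ ()) (λ ())
enumeration (k ∷ ks) = ↔-trans +↔⊎ (↔-refl ⊎-↔ enumeration ks)

CycleIso : List ℕ → ∀ {n} → Graph n → Set
CycleIso ks {n} F = Σ (Vertex ks ↔ Fin n) λ f →
  ∀ x y → F (Inverse.to f x) (Inverse.to f y) ≡ cycles ks x y

allVertices? : ∀ ks {P : Vertex ks → Set} → (∀ v → Dec (P v)) → Dec (∀ v → P v)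
allVertices? ks {P} P? = map′
  (λ h v → subst P (Inverse.strictlyInverseˡ e v) (h (Inverse.from e v)))
  (λ h i → h (Inverse.to e i))
  (all? (λ i → P? (Inverse.to e i)))
  where
  e = enumeration ks

_≟ᵛ_ : ∀ {ks} (x y : Vertex ks) → Dec (x ≡ y)
_≟ᵛ_ {k ∷ ks} = Sum.≡-dec Fin._≟_ _≟ᵛ_

cycAdj-cases : ∀ k a b → cycAdj k a b ≡ true →
  suc a ≡ b ⊎ suc b ≡ a ⊎ (a ≡ 0 × suc b ≡ k) ⊎ (b ≡ 0 × suc a ≡ k)
cycAdj-cases k a b h =
  Sum.map (≡ᵇ⇒≡ (suc a) b)
    (Sum.map (≡ᵇ⇒≡ (suc b) a)
      (Sum.map (both a (suc b)) (both b (suc a)) ∘ Equivalence.to Bool.T-∨)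
      ∘ Equivalence.to Bool.T-∨)
    (Equivalence.to Bool.T-∨ (Equivalence.from Bool.T-≡ h))
  where
  both : ∀ x y → T ((x ≡ᵇ 0) ∧ (y ≡ᵇ k)) → x ≡ 0 × y ≡ k
  both x y t with Equivalence.to Bool.T-∧ t
  ... | t₁ , t₂ = ≡ᵇ⇒≡ x 0 t₁ , ≡ᵇ⇒≡ y k t₂

cycAdj-complete : ∀ k a b → suc a ≡ b ⊎ suc b ≡ a ⊎ (a ≡ 0 × suc b ≡ k) ⊎ (b ≡ 0 × suc a ≡ k) →
  cycAdj k a b ≡ true
cycAdj-complete k a b h = Equivalence.to Bool.T-≡
  (Equivalence.from Bool.T-∨ (Sum.map (≡⇒≡ᵇ _ _)
    (Equivalence.from Bool.T-∨ ∘ Sum.map (≡⇒≡ᵇ _ _)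
      (Equivalence.from (Bool.T-∨ {(a ≡ᵇ 0) ∧ (suc b ≡ᵇ k)}) ∘ Sum.map both both)) h))
  where
  both : ∀ {x y z w} → x ≡ y × z ≡ w → T ((x ≡ᵇ y) ∧ (z ≡ᵇ w))
  both (e₁ , e₂) = Equivalence.from Bool.T-∧ (≡⇒≡ᵇ _ _ e₁ , ≡⇒≡ᵇ _ _ e₂)

-- The alternating numbering of a long cycle

alternate : ℕ → ℕ → ℕ
alternate h zero          = 0
alternate h (suc zero)    = h
alternate h (suc (suc i)) = suc (alternate h i)

-- The sequence is 0, `h`, 1, `h + 1`, 2, ..., whose steps have sizes `h` and `h - 1`; both are at
-- least 3.
alternate-consecutive : ∀ {h} → 4 ≤ h → ∀ i → Far (alternate h i) (alternate h (suc i))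
alternate-consecutive 4≤h zero          = inj₁ (<⇒≤ 4≤h)
alternate-consecutive 4≤h (suc zero)    = inj₂ 4≤h
alternate-consecutive 4≤h (suc (suc i)) = far-suc (alternate-consecutive 4≤h i)

alternate< : ∀ {h} → 1 ≤ h → ∀ i → alternate h i < h + ⌊ suc i /2⌋
alternate< {h} 1≤h zero          = subst (1 ≤_) (sym (+-identityʳ h)) 1≤h
alternate< {h} 1≤h (suc zero)    = ≤-reflexive (+-comm 1 h)
alternate< {h} 1≤h (suc (suc i)) =
  subst (suc (alternate h (2 + i)) ≤_) (sym (+-suc h ⌊ suc i /2⌋)) (s≤s (alternate< 1≤h i))

alternate-high-or-half : ∀ h i → h ≤ alternate h i ⊎ alternate h i + alternate h i ≡ i
alternate-high-or-half h zero          = inj₂ refl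
alternate-high-or-half h (suc zero)    = inj₁ ≤-refl
alternate-high-or-half h (suc (suc i)) = Sum.map m≤n⇒m≤1+n
  (λ e → cong suc (trans (+-suc _ _) (cong suc e)))
  (alternate-high-or-half h i)

-- The right side is the term at index `2 + i`. An odd index gives a term above `h`; an even one
-- gives half the index, which is below `h` by the bound.
h≢alternate : ∀ {h} i → 2 + i < h + h → h ≢ suc (alternate h i)
h≢alternate {h} i i<2h eq with alternate-high-or-half h i
... | inj₁ h≤ = <⇒≱ (≤-reflexive (sym eq)) h≤
... | inj₂ e  = <⇒≢ i<2h (trans (cong (2 +_) (sym e))
  (trans (cong suc (sym (+-suc _ _))) (cong₂ _+_ (sym eq) (sym eq))))

alternate-injective : ∀ {h} → 1 ≤ h → ∀ i j → i < h + h → j < h + h →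
  alternate h i ≡ alternate h j → i ≡ j
alternate-injective 1≤h zero          zero          _ _ _ = refl
alternate-injective 1≤h zero          (suc zero)    _ _ e = contradiction e (<⇒≢ 1≤h)
alternate-injective 1≤h zero          (suc (suc j)) _ _ ()
alternate-injective 1≤h (suc zero)    zero          _ _ e = contradiction (sym e) (<⇒≢ 1≤h)
alternate-injective 1≤h (suc zero)    (suc zero)    _ _ _ = refl
alternate-injective 1≤h (suc zero)    (suc (suc j)) _ q e = contradiction e (h≢alternate j q)
alternate-injective 1≤h (suc (suc i)) zero          _ _ ()
alternate-injective 1≤h (suc (suc i)) (suc zero)    p _ e = contradiction (sym e) (h≢alternate i p)
alternate-injective 1≤h (suc (suc i)) (suc (suc j)) p q e = cong (2 +_)
  (alternate-injective 1≤h i j (≤-trans (m≤n+m _ 2) p) (≤-trans (m≤n+m _ 2) q) (suc-injective e))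

-- Here `h` is half of `k`, rounded up: `7 ≤ k` makes it at least 4, and `k ≤ h + h` prevents the
-- lower half from running into the upper one. Only the closing edge of the cycle needs a separate
-- check.
long-cycle : ∀ k → 7 ≤ k → Spread (C k) k
long-cycle k 7≤k = record
  { label     = λ i → alternate h (toℕ i)
  ; injective = λ {i} {j} → toℕ-injective ∘
      alternate-injective 1≤h (toℕ i) (toℕ j) (<-≤-trans (toℕ<n i) k≤2h) (<-≤-trans (toℕ<n j) k≤2h)
  ; bounded   = λ i → ≤-trans (alternate< 1≤h (toℕ i))
      (≤-trans (+-monoʳ-≤ h (⌊n/2⌋-mono (toℕ<n i)))
        (≤-reflexive (trans (+-comm h ⌊ k /2⌋) (⌊n/2⌋+⌈n/2⌉≡n k))))
  ; far       = λ i j → far (toℕ i) (toℕ j) ∘ cycAdj-cases k (toℕ i) (toℕ j)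
  }
  where
  h = ⌈ k /2⌉

  4≤h : 4 ≤ h
  4≤h = ⌈n/2⌉-mono 7≤k

  1≤h : 1 ≤ h
  1≤h = ≤-trans (s≤s z≤n) 4≤h

  k≤2h : k ≤ h + h
  k≤2h = ≤-trans (≤-reflexive (sym (⌊n/2⌋+⌈n/2⌉≡n k))) (+-monoˡ-≤ h (⌊n/2⌋≤⌈n/2⌉ k))

  last-high : ∀ i → 7 ≤ suc i → 3 ≤ alternate h i
  last-high i 7≤1+i with m≤n⇒∃[o]m+o≡n (s≤s⁻¹ 7≤1+i)
  -- Every two steps raise the sequence by one, so at index `6 + o` its term is 3 plus an earlier
  -- term.
  ... | o , refl = s≤s (s≤s (s≤s z≤n))

  far : ∀ a b → suc a ≡ b ⊎ suc b ≡ a ⊎ (a ≡ 0 × suc b ≡ k) ⊎ (b ≡ 0 × suc a ≡ k) →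
    Far (alternate h a) (alternate h b)
  far a _ (inj₁ refl)                        = alternate-consecutive 4≤h a
  far _ b (inj₂ (inj₁ refl))                 = far-sym (alternate-consecutive 4≤h b)
  far _ b (inj₂ (inj₂ (inj₁ (refl , 1+b≡k)))) = inj₁ (last-high b (subst (7 ≤_) (sym 1+b≡k) 7≤k))
  far a _ (inj₂ (inj₂ (inj₂ (refl , 1+a≡k)))) = inj₂ (last-high a (subst (7 ≤_) (sym 1+a≡k) 7≤k))

-- A k-cycle occupying the labels `slot`, while the labels of another graph are moved
-- by the increasing map `shift` into the places that are left free.
record Slots (k : ℕ) : Set where
  field
    slot       : Fin k → ℕ
    injective  : ∀ i j → slot i ≡ slot j → i ≡ j
    bounded    : ∀ i → slot i < 4 + k
    far        : ∀ i j → C k i j ≡ true → Far (slot i) (slot j)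
    shift      : ℕ → ℕ
    increasing : ∀ m → shift m < shift (suc m)
    shift≤     : ∀ m → shift m ≤ k + m
    disjoint   : ∀ m i → slot i ≢ shift m

module _ {k : ℕ} (S : Slots k) where
  open Slots S

  -- A strictly increasing map on the naturals never shrinks a gap, so far labels stay far and
  -- distinct labels stay distinct after shifting.
  shift-expands : ∀ d {a b} → d + a ≤ b → d + shift a ≤ shift b
  shift-expands d {a} d+a≤b with m≤n⇒∃[o]m+o≡n d+a≤b
  ... | o , refl = ≤-trans (shift-+ d) (shift-mono o)
    where
    shift-+ : ∀ d → d + shift a ≤ shift (d + a)
    shift-+ zero    = ≤-refl
    shift-+ (suc d) = ≤-trans (s≤s (shift-+ d)) (increasing (d + a))

    shift-mono : ∀ o → shift (d + a) ≤ shift (d + a + o)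
    shift-mono zero    = ≤-reflexive (cong shift (sym (+-identityʳ (d + a))))
    shift-mono (suc o) = ≤-trans (shift-mono o)
      (≤-trans (<⇒≤ (increasing (d + a + o))) (≤-reflexive (cong shift (sym (+-suc (d + a) o)))))

  shift-far : ∀ {a b} → Far a b → Far (shift a) (shift b)
  shift-far = Sum.map (shift-expands 3) (shift-expands 3)

  shift-injective : ∀ {a b} → shift a ≡ shift b → a ≡ b
  shift-injective {a} {b} e with <-cmp a b
  ... | tri< a<b _ _ = contradiction e (<⇒≢ (shift-expands 1 a<b))
  ... | tri≈ _ a≡b _ = a≡b
  ... | tri> _ _ b<a = contradiction (sym e) (<⇒≢ (shift-expands 1 b<a))

  -- The slots lie below `4 + k`, so `4 ≤ N` keeps them within the `k + N` labels available.
  add-cycle : ∀ {X : Set} {adj : X → X → Bool} {N} → Spread adj N → 4 ≤ N →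
    Spread (C k ⊕ adj) (k + N)
  add-cycle {adj = adj} {N} G 4≤N = record
    { label     = [ slot , shift ∘ G.label ]
    ; injective = λ
      { {inj₁ i} {inj₁ j} e → cong inj₁ (injective i j e)
      ; {inj₁ i} {inj₂ y} e → contradiction e (disjoint (G.label y) i)
      ; {inj₂ x} {inj₁ j} e → contradiction (sym e) (disjoint (G.label x) j)
      ; {inj₂ x} {inj₂ y} e → cong inj₂ (G.injective (shift-injective e)) }
    ; bounded   = λ
      { (inj₁ i) → ≤-trans (bounded i) (≤-trans (+-monoˡ-≤ k 4≤N) (≤-reflexive (+-comm N k)))
      ; (inj₂ x) → ≤-<-trans (shift≤ (G.label x)) (+-monoʳ-< k (G.bounded x)) }
    ; far       = λ
      { (inj₁ i) (inj₁ j) e → far i j e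
      ; (inj₂ x) (inj₂ y) e → shift-far (G.far x y e) }
    }
    where
    module G = Spread G

-- Slots for a cycle of each length

data Size : ℕ → Set where
  three : Size 3
  four  : Size 4
  five  : Size 5
  six   : Size 6
  long  : ∀ {k} → 7 ≤ k → Size k

size : ∀ {k} → 3 ≤ k → Size k
size {suc (suc (suc zero))} _ = three
size {suc (suc (suc (suc zero)))} _ = four
size {suc (suc (suc (suc (suc zero))))} _ = five
size {suc (suc (suc (suc (suc (suc zero)))))} _ = six
size {suc (suc (suc (suc (suc (suc (suc k))))))} _ = long (m≤m+n 7 k)
size {suc zero} (s≤s ())
size {suc (suc zero)} (s≤s (s≤s ()))

tableInjective? : ∀ {k} (t : Vec ℕ k) → Dec (∀ i j → lookup t i ≡ lookup t j → i ≡ j)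
tableInjective? t = all? λ i → all? λ j → (lookup t i ≟ lookup t j) →-dec (i Fin.≟ j)

tableBounded? : ∀ {k} (t : Vec ℕ k) → Dec (∀ i → lookup t i < 4 + k)
tableBounded? t = all? λ i → _ <? _

tableFar? : ∀ {k} (t : Vec ℕ k) → Dec (∀ i j → C k i j ≡ true → Far (lookup t i) (lookup t j))
tableFar? t = all? λ i → all? λ j → (_ Bool.≟ true) →-dec far? (lookup t i) (lookup t j)

clear? : ∀ {k} (t : Vec ℕ k) s → Dec (∀ i → lookup t i ≢ s)
clear? t s = all? λ i → ¬? (lookup t i ≟ s)

-- In each case `shift` enumerates the labels missed by the slots. The triangle dictates the
-- constant 4: three labels pairwise at distance 3 span seven labels, four of which belong to other
-- vertices.
slots : ∀ {k} → Size k → Slots k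
slots three = record
  { slot       = lookup t
  ; injective  = toWitness {a? = tableInjective? t} tt
  ; bounded    = toWitness {a? = tableBounded? t} tt
  ; far        = toWitness {a? = tableFar? t} tt
  ; shift      = λ { 0 → 1 ; 1 → 2 ; 2 → 4 ; 3 → 5 ; m → 3 + m }
  ; increasing = λ { 0 → ≤-refl ; 1 → n≤1+n 3 ; 2 → ≤-refl ; 3 → n≤1+n 6
                   ; (suc (suc (suc (suc m)))) → ≤-refl }
  ; shift≤     = λ { 0 → m≤n+m 1 2 ; 1 → m≤n+m 2 2 ; 2 → m≤n+m 4 1 ; 3 → m≤n+m 5 1
                   ; (suc (suc (suc (suc m)))) → ≤-refl }
  ; disjoint   = λ
    { 0 → toWitness {a? = clear? t 1} tt
    ; 1 → toWitness {a? = clear? t 2} tt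
    ; 2 → toWitness {a? = clear? t 4} tt
    ; 3 → toWitness {a? = clear? t 5} tt
    -- The test evaluates with `m` left open, because every slot is a numeral below 7.
    ; (suc (suc (suc (suc m)))) → toWitness {a? = clear? t (7 + m)} tt }
  }
  where t = 0 ∷ 3 ∷ 6 ∷ []
slots four = record
  { slot       = lookup t
  ; injective  = toWitness {a? = tableInjective? t} tt
  ; bounded    = toWitness {a? = tableBounded? t} tt
  ; far        = toWitness {a? = tableFar? t} tt
  ; shift      = λ { 0 → 2 ; 1 → 3 ; m → 4 + m }
  ; increasing = λ { 0 → ≤-refl ; 1 → m≤n+m 4 2 ; (suc (suc m)) → ≤-refl }
  ; shift≤     = λ { 0 → m≤n+m 2 2 ; 1 → m≤n+m 3 2 ; (suc (suc m)) → ≤-refl }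
  ; disjoint   = λ
    { 0 → toWitness {a? = clear? t 2} tt
    ; 1 → toWitness {a? = clear? t 3} tt
    ; (suc (suc m)) → toWitness {a? = clear? t (6 + m)} tt }
  }
  where t = 0 ∷ 4 ∷ 1 ∷ 5 ∷ []
slots five = record
  { slot       = lookup t
  ; injective  = toWitness {a? = tableInjective? t} tt
  ; bounded    = toWitness {a? = tableBounded? t} tt
  ; far        = toWitness {a? = tableFar? t} tt
  ; shift      = λ { 0 → 1 ; 1 → 4 ; m → 5 + m }
  ; increasing = λ { 0 → m≤n+m 2 2 ; 1 → m≤n+m 5 2 ; (suc (suc m)) → ≤-refl }
  ; shift≤     = λ { 0 → m≤n+m 1 4 ; 1 → m≤n+m 4 2 ; (suc (suc m)) → ≤-refl }
  ; disjoint   = λ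
    { 0 → toWitness {a? = clear? t 1} tt
    ; 1 → toWitness {a? = clear? t 4} tt
    ; (suc (suc m)) → toWitness {a? = clear? t (7 + m)} tt }
  }
  where t = 0 ∷ 3 ∷ 6 ∷ 2 ∷ 5 ∷ []
slots six = record
  { slot       = lookup t
  ; injective  = toWitness {a? = tableInjective? t} tt
  ; bounded    = toWitness {a? = tableBounded? t} tt
  ; far        = toWitness {a? = tableFar? t} tt
  ; shift      = λ { 0 → 3 ; m → 6 + m }
  ; increasing = λ { 0 → m≤n+m 4 3 ; (suc m) → ≤-refl }
  ; shift≤     = λ { 0 → m≤n+m 3 3 ; (suc m) → ≤-refl }
  ; disjoint   = λ
    { 0 → toWitness {a? = clear? t 3} tt
    ; (suc m) → toWitness {a? = clear? t (7 + m)} tt }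
  }
  where t = 0 ∷ 6 ∷ 2 ∷ 5 ∷ 1 ∷ 4 ∷ []
slots {k} (long 7≤k) = record
  { slot       = L.label
  ; injective  = λ _ _ → L.injective
  ; bounded    = λ i → ≤-trans (L.bounded i) (m≤n+m k 4)
  ; far        = L.far
  ; shift      = k +_
  ; increasing = λ m → ≤-reflexive (sym (+-suc k m))
  ; shift≤     = λ _ → ≤-refl
  ; disjoint   = λ m i e → <⇒≱ (L.bounded i) (subst (k ≤_) (sym e) (m≤m+n k m))
  }
  where module L = Spread (long-cycle k 7≤k)

-- Classification of sorted lists of cycle lengths

data Exceptional : List ℕ → Set where
  c₃  : Exceptional (3 ∷ [])
  c₄  : Exceptional (4 ∷ [])
  c₅  : Exceptional (5 ∷ [])
  c₆  : Exceptional (6 ∷ [])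
  c₃₃ : Exceptional (3 ∷ 3 ∷ [])
  c₃₄ : Exceptional (3 ∷ 4 ∷ [])

fromTables : ∀ {ks} → All (Vec ℕ) ks → Vertex ks → ℕ
fromTables (t ∷ ts) = [ lookup t , fromTables ts ]

tables? : ∀ {ks} (ts : All (Vec ℕ) ks) → let label = fromTables ts in
  Dec ((∀ x y → label x ≡ label y → x ≡ y) ×
       (∀ x → label x < sum ks) ×
       (∀ x y → cycles ks x y ≡ true → Far (label x) (label y)))
tables? {ks} ts =
  (allVertices? ks λ x → allVertices? ks λ y → (label x ≟ label y) →-dec (x ≟ᵛ y)) ×-dec
  (allVertices? ks λ x → _ <? _) ×-dec
  (allVertices? ks λ x → allVertices? ks λ y → (_ Bool.≟ true) →-dec far? (label x) (label y))
  where label = fromTables ts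

-- The implicit argument is solved by evaluating the decision, so an explicit numbering needs no
-- proof beyond its tables.
tables : ∀ {ks} (ts : All (Vec ℕ) ks) {_ : True (tables? ts)} → Spread (cycles ks) (sum ks)
tables ts {ok} with toWitness ok
... | inj , bnd , far = record
  { label = fromTables ts ; injective = inj _ _ ; bounded = bnd ; far = far }

-- The bound is carried along because `add-cycle` asks for it when a further cycle is added.
Spreadable : List ℕ → Set
Spreadable ks = 4 ≤ sum ks × Spread (cycles ks) (sum ks)

exceptional-head≤6 : ∀ {k ks} → Exceptional ks → All (k ≤_) ks → k ≤ 6
exceptional-head≤6 c₃  (h ∷ _) = ≤-trans h (m≤n+m 3 3)
exceptional-head≤6 c₄  (h ∷ _) = ≤-trans h (m≤n+m 4 2)
exceptional-head≤6 c₅  (h ∷ _) = ≤-trans h (m≤n+m 5 1)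
exceptional-head≤6 c₆  (h ∷ _) = h
exceptional-head≤6 c₃₃ (h ∷ _) = ≤-trans h (m≤n+m 3 3)
exceptional-head≤6 c₃₄ (h ∷ _) = ≤-trans h (m≤n+m 3 3)

-- The new cycle is a shortest one, which leaves few combinations and excludes a long head. Apart
-- from the two exceptional pairs, each combination has an explicit numbering.
classify-cons : ∀ {k ks} → Size k → Exceptional ks → All (k ≤_) ks →
  Exceptional (k ∷ ks) ⊎ Spreadable (k ∷ ks)
classify-cons three c₃  _ = inj₁ c₃₃
classify-cons three c₄  _ = inj₁ c₃₄
classify-cons three c₅  _ = inj₂ (m≤m+n 4 4 ,
  tables ((0 ∷ 3 ∷ 6 ∷ []) ∷ (1 ∷ 4 ∷ 7 ∷ 2 ∷ 5 ∷ []) ∷ []))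
classify-cons three c₆  _ = inj₂ (m≤m+n 4 5 ,
  tables ((0 ∷ 3 ∷ 6 ∷ []) ∷ (1 ∷ 4 ∷ 7 ∷ 2 ∷ 5 ∷ 8 ∷ []) ∷ []))
classify-cons three c₃₃ _ = inj₂ (m≤m+n 4 5 ,
  tables ((0 ∷ 3 ∷ 6 ∷ []) ∷ (1 ∷ 4 ∷ 7 ∷ []) ∷ (2 ∷ 5 ∷ 8 ∷ []) ∷ []))
classify-cons three c₃₄ _ = inj₂ (m≤m+n 4 6 ,
  tables ((0 ∷ 3 ∷ 6 ∷ []) ∷ (1 ∷ 4 ∷ 7 ∷ []) ∷ (2 ∷ 8 ∷ 5 ∷ 9 ∷ []) ∷ []))
classify-cons four  c₃  (s≤s (s≤s (s≤s ())) ∷ _)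
classify-cons four  c₄  _ = inj₂ (m≤m+n 4 4 ,
  tables ((0 ∷ 3 ∷ 7 ∷ 4 ∷ []) ∷ (1 ∷ 5 ∷ 2 ∷ 6 ∷ []) ∷ []))
classify-cons four  c₅  _ = inj₂ (m≤m+n 4 5 ,
  tables ((0 ∷ 3 ∷ 7 ∷ 4 ∷ []) ∷ (1 ∷ 5 ∷ 8 ∷ 2 ∷ 6 ∷ []) ∷ []))
classify-cons four  c₆  _ = inj₂ (m≤m+n 4 6 ,
  tables ((0 ∷ 3 ∷ 6 ∷ 9 ∷ []) ∷ (1 ∷ 4 ∷ 7 ∷ 2 ∷ 5 ∷ 8 ∷ []) ∷ []))
classify-cons four  c₃₃ (s≤s (s≤s (s≤s ())) ∷ _)
classify-cons four  c₃₄ (s≤s (s≤s (s≤s ())) ∷ _)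
classify-cons five  c₃  (s≤s (s≤s (s≤s ())) ∷ _)
classify-cons five  c₄  (s≤s (s≤s (s≤s (s≤s ()))) ∷ _)
classify-cons five  c₅  _ = inj₂ (m≤m+n 4 6 ,
  tables ((0 ∷ 3 ∷ 6 ∷ 1 ∷ 7 ∷ []) ∷ (2 ∷ 5 ∷ 8 ∷ 4 ∷ 9 ∷ []) ∷ []))
classify-cons five  c₆  _ = inj₂ (m≤m+n 4 7 ,
  tables ((0 ∷ 3 ∷ 6 ∷ 1 ∷ 7 ∷ []) ∷ (2 ∷ 8 ∷ 4 ∷ 9 ∷ 5 ∷ 10 ∷ []) ∷ []))
classify-cons five  c₃₃ (s≤s (s≤s (s≤s ())) ∷ _)
classify-cons five  c₃₄ (s≤s (s≤s (s≤s ())) ∷ _)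
classify-cons six   c₃  (s≤s (s≤s (s≤s ())) ∷ _)
classify-cons six   c₄  (s≤s (s≤s (s≤s (s≤s ()))) ∷ _)
classify-cons six   c₅  (s≤s (s≤s (s≤s (s≤s (s≤s ())))) ∷ _)
classify-cons six   c₆  _ = inj₂ (m≤m+n 4 8 ,
  tables ((0 ∷ 3 ∷ 6 ∷ 1 ∷ 4 ∷ 8 ∷ []) ∷ (2 ∷ 9 ∷ 5 ∷ 10 ∷ 7 ∷ 11 ∷ []) ∷ []))
classify-cons six   c₃₃ (s≤s (s≤s (s≤s ())) ∷ _)
classify-cons six   c₃₄ (s≤s (s≤s (s≤s ())) ∷ _)
classify-cons (long 7≤k) e k≤ = contradiction (exceptional-head≤6 e k≤) (<⇒≱ 7≤k)

spread-single : ∀ {k} → Spread (C k) k → Spread (cycles (k ∷ [])) (k + 0)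
spread-single {k} G = record
  { label     = λ { (inj₁ i) → label i }
  ; injective = λ { {inj₁ i} {inj₁ j} e → cong inj₁ (injective e) }
  ; bounded   = λ { (inj₁ i) → subst (label i <_) (sym (+-identityʳ k)) (bounded i) }
  ; far       = λ { (inj₁ i) (inj₁ j) e → far i j e }
  }
  where open Spread G

-- The list is sorted upwards, so recursion on the tail treats the longer cycles first. Once a tail
-- has a numbering, every remaining cycle is squeezed in by its slots; only exceptional tails need
-- the tables.
classify : ∀ ks → All (3 ≤_) ks → AllPairs _≤_ ks → ks ≡ [] ⊎ Exceptional ks ⊎ Spreadable ks
classify [] _ _ = inj₁ refl
classify (k ∷ ks) (3≤k ∷ 3≤ks) (k≤ks ∷ sorted) with classify ks 3≤ks sorted
... | inj₂ (inj₁ e) = inj₂ (classify-cons (size 3≤k) e k≤ks)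
... | inj₂ (inj₂ (4≤ , G)) = inj₂ (inj₂ (≤-trans 4≤ (m≤n+m (sum ks) k) , add-cycle (slots (size 3≤k)) G 4≤))
... | inj₁ refl with size 3≤k
...   | three = inj₂ (inj₁ c₃)
...   | four  = inj₂ (inj₁ c₄)
...   | five  = inj₂ (inj₁ c₅)
...   | six   = inj₂ (inj₁ c₆)
...   | long 7≤k = inj₂ (inj₂
  ( ≤-trans (≤-trans (m≤m+n 4 3) 7≤k) (m≤m+n k 0) , spread-single (long-cycle k 7≤k)))

-- Decomposition of 2-regular graphs into cycles

true≢false : ∀ {b} → b ≡ true → b ≡ false → ⊥
true≢false refl ()

bool-ext : ∀ {x y : Bool} → (x ≡ true → y ≡ true) → (y ≡ true → x ≡ true) → x ≡ y
bool-ext {false} {false} f g = refl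
bool-ext {false} {true}  f g = g refl
bool-ext {true}  {false} f g = sym (f refl)
bool-ext {true}  {true}  f g = refl

module _ {A : Set} (P : A → Bool) where

  -- Has the shape of the sum in `deg`, so that regularity is directly a statement about
  -- `count (F v)`.
  count : List A → ℕ
  count xs = sum (map (λ x → if P x then 1 else 0) xs)

  count-none : ∀ xs → count xs ≡ 0 → ∀ {x} → x ∈ xs → P x ≢ true
  count-none (x ∷ xs) e h Px with P x in eq
  count-none (x ∷ xs) e (here refl) Px | false = true≢false Px eq
  count-none (x ∷ xs) e (there x∈)  Px | false = count-none xs e x∈ Px

  count-one : ∀ xs → count xs ≡ 1 →
    ∃ λ a → a ∈ xs × P a ≡ true × (∀ {x} → x ∈ xs → P x ≡ true → x ≡ a)
  count-one (x ∷ xs) e with P x in eq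
  ... | true = x , here refl , eq , λ
    { (here y≡x) _ → y≡x ; (there y∈) Py → contradiction Py (count-none xs (suc-injective e) y∈) }
  ... | false with count-one xs e
  ...   | a , a∈ , Pa , unique = a , there a∈ , Pa , λ
    { (here refl) Py → ⊥-elim (true≢false Py eq) ; (there y∈) Py → unique y∈ Py }

  count-two : ∀ xs → Unique xs → count xs ≡ 2 →
    ∃ λ a → ∃ λ b → a ≢ b × P a ≡ true × P b ≡ true × (∀ {x} → x ∈ xs → P x ≡ true → x ≡ a ⊎ x ≡ b)
  count-two (x ∷ xs) (x∉xs ∷ uniq) e with P x in eq
  ... | true with count-one xs (suc-injective e)
  ...   | b , b∈ , Pb , unique = x , b , All.lookup x∉xs b∈ , eq , Pb , λ
    { (here y≡x) _ → inj₁ y≡x ; (there y∈) Py → inj₂ (unique y∈ Py) }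
  count-two (x ∷ xs) (x∉xs ∷ uniq) e | false with count-two xs uniq e
  ...   | a , b , a≢b , Pa , Pb , only = a , b , a≢b , Pa , Pb , λ
    { (here refl) Py → ⊥-elim (true≢false Py eq) ; (there y∈) Py → only y∈ Py }

-- Inserting a cycle length into a sorted list

data Insertion (k : ℕ) : List ℕ → List ℕ → Set where
  here  : ∀ {ks} → Insertion k ks (k ∷ ks)
  there : ∀ {j ks ls} → Insertion k ks ls → Insertion k (j ∷ ks) (j ∷ ls)

insertion-all : ∀ {k ks ls} {P : ℕ → Set} → Insertion k ks ls → P k → All P ks → All P ls
insertion-all here      pk ps       = pk ∷ ps
insertion-all (there i) pk (p ∷ ps) = p ∷ insertion-all i pk ps

insert-sorted : ∀ k {ks} → AllPairs _≤_ ks → ∃ λ ls → Insertion k ks ls × AllPairs _≤_ ls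
insert-sorted k {[]}     []          = k ∷ [] , here , [] ∷ []
insert-sorted k {j ∷ ks} (j≤ ∷ sorted) with k ≤? j
... | yes k≤j = k ∷ j ∷ ks , here , (k≤j ∷ All.map (≤-trans k≤j) j≤) ∷ j≤ ∷ sorted
... | no k≰j with insert-sorted k sorted
...   | ls , i , sorted′ = j ∷ ls , there i , insertion-all i (<⇒≤ (≰⇒> k≰j)) j≤ ∷ sorted′

-- Cycles are discovered in arbitrary order but classified in sorted order; `split` and `merge`
-- carry the vertices from one order to the other.
split : ∀ {k ks ls} → Insertion k ks ls → Vertex ls → Vertex (k ∷ ks)
split here      v        = v
split (there i) (inj₁ x) = inj₂ (inj₁ x)
split (there i) (inj₂ v) = [ inj₁ , inj₂ ∘ inj₂ ]′ (split i v)

merge : ∀ {k ks ls} → Insertion k ks ls → Vertex (k ∷ ks) → Vertex ls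
merge here      v               = v
merge (there i) (inj₁ x)        = inj₂ (merge i (inj₁ x))
merge (there i) (inj₂ (inj₁ x)) = inj₁ x
merge (there i) (inj₂ (inj₂ v)) = inj₂ (merge i (inj₂ v))

split-merge : ∀ {k ks ls} (i : Insertion k ks ls) v → split i (merge i v) ≡ v
split-merge here      v               = refl
split-merge (there i) (inj₁ x)        = cong [ inj₁ , inj₂ ∘ inj₂ ]′ (split-merge i (inj₁ x))
split-merge (there i) (inj₂ (inj₁ x)) = refl
split-merge (there i) (inj₂ (inj₂ v)) = cong [ inj₁ , inj₂ ∘ inj₂ ]′ (split-merge i (inj₂ v))

merge-split : ∀ {k ks ls} (i : Insertion k ks ls) v → merge i (split i v) ≡ v
merge-split here      v        = refl
merge-split (there i) (inj₁ x) = refl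
merge-split (there i) (inj₂ v) with split i v | merge-split i v
... | inj₁ x | e = cong inj₂ e
... | inj₂ y | e = cong inj₂ e

split-adjacent : ∀ {k ks ls} (i : Insertion k ks ls) u v →
  cycles (k ∷ ks) (split i u) (split i v) ≡ cycles ls u v
split-adjacent here      u        v        = refl
split-adjacent (there i) (inj₁ x) (inj₁ y) = refl
split-adjacent (there i) (inj₁ x) (inj₂ v) with split i v
... | inj₁ _ = refl
... | inj₂ _ = refl
split-adjacent (there i) (inj₂ u) (inj₁ y) with split i u
... | inj₁ _ = refl
... | inj₂ _ = refl
split-adjacent (there i) (inj₂ u) (inj₂ v) with split i u | split i v | split-adjacent i u v
... | inj₁ _ | inj₁ _ | e = e
... | inj₁ _ | inj₂ _ | e = e
... | inj₂ _ | inj₁ _ | e = e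
... | inj₂ _ | inj₂ _ | e = e

insertion-sum : ∀ {k ks ls} → Insertion k ks ls → sum ls ≡ k + sum ks
insertion-sum here = refl
insertion-sum {k} (there {j} {ks} {ls} i) = begin
  j + sum ls         ≡⟨ cong (j +_) (insertion-sum i) ⟩
  j + (k + sum ks)   ≡⟨ +-assoc j k (sum ks) ⟨
  j + k + sum ks     ≡⟨ cong (_+ sum ks) (+-comm j k) ⟩
  k + j + sum ks     ≡⟨ +-assoc k j (sum ks) ⟩
  k + (j + sum ks)   ∎
  where open ≡-Reasoning

-- Walks that close up to cycles

module Decomposition {n : ℕ} (F : Graph n) (F-sym : Symmetric F) (F-irrefl : Loopless F)
  (F-regular : TwoRegular F) where

  _~_ : Fin n → Fin n → Set
  u ~ v = F u v ≡ true

  ~-sym : ∀ {u v} → u ~ v → v ~ u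
  ~-sym {u} {v} = trans (F-sym v u)

  ~⇒≢ : ∀ {u v} → u ~ v → u ≢ v
  ~⇒≢ {u} e refl = true≢false e (F-irrefl u)

  neighbours : ∀ v → ∃ λ a → ∃ λ b → a ≢ b × v ~ a × v ~ b × (∀ {x} → x ∈ allFin n → v ~ x → x ≡ a ⊎ x ≡ b)
  neighbours v = count-two (F v) (allFin n) (allFin⁺ n) (F-regular v)

  -- Any two distinct known neighbours exhaust the neighbourhood, so the particular pair chosen by
  -- `neighbours` never matters later.
  two-neighbours : ∀ {v x y z} → v ~ x → v ~ y → x ≢ y → v ~ z → z ≡ x ⊎ z ≡ y
  two-neighbours {v} {x} {y} {z} vx vy x≢y vz with neighbours v
  ... | a , b , _ , _ , _ , only with only (∈-allFin x) vx | only (∈-allFin y) vy | only (∈-allFin z) vz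
  ... | inj₁ x≡a | inj₁ y≡a | _        = contradiction (trans x≡a (sym y≡a)) x≢y
  ... | inj₂ x≡b | inj₂ y≡b | _        = contradiction (trans x≡b (sym y≡b)) x≢y
  ... | inj₁ x≡a | inj₂ _   | inj₁ z≡a = inj₁ (trans z≡a (sym x≡a))
  ... | inj₁ _   | inj₂ y≡b | inj₂ z≡b = inj₂ (trans z≡b (sym y≡b))
  ... | inj₂ _   | inj₁ y≡a | inj₁ z≡a = inj₂ (trans z≡a (sym y≡a))
  ... | inj₂ x≡b | inj₁ _   | inj₂ z≡b = inj₁ (trans z≡b (sym x≡b))

  another : ∀ v u → ∃ λ x → v ~ x × x ≢ u
  another v u with neighbours v
  ... | a , b , a≢b , va , vb , _ with a Fin.≟ u
  ...   | yes a≡u = b , vb , λ b≡u → a≢b (trans a≡u (sym b≡u))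
  ...   | no  a≢u = a , va , a≢u

  module Walk (s : Fin n) where

    walk : ℕ → Fin n
    walk zero          = s
    -- There is no previous vertex yet; excluding `s` itself is harmless, as `s` is not its own
    -- neighbour.
    walk (suc zero)    = proj₁ (another s s)
    walk (suc (suc t)) = proj₁ (another (walk (suc t)) (walk t))

    walk-~ : ∀ t → walk t ~ walk (suc t)
    walk-~ zero    = proj₁ (proj₂ (another s s))
    walk-~ (suc t) = proj₁ (proj₂ (another (walk (suc t)) (walk t)))

    walk-turn : ∀ t → walk (2 + t) ≢ walk t
    walk-turn t = proj₂ (proj₂ (another (walk (suc t)) (walk t)))

    walk-neighbours : ∀ t {z} → walk (suc t) ~ z → z ≡ walk t ⊎ z ≡ walk (2 + t)
    walk-neighbours t = two-neighbours (~-sym (walk-~ t)) (walk-~ (suc t)) (walk-turn t ∘ sym)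

    InjectiveTo : ℕ → Set
    InjectiveTo t = ∀ {i j} → i < j → j ≤ t → walk i ≢ walk j

    injective-to : ∀ {t} → InjectiveTo t → ∀ {i j} → i ≤ t → j ≤ t → walk i ≡ walk j → i ≡ j
    injective-to inj {i} {j} i≤t j≤t e with <-cmp i j
    ... | tri< i<j _ _ = contradiction e (inj i<j j≤t)
    ... | tri≈ _ i≡j _ = i≡j
    ... | tri> _ _ j<i = contradiction (sym e) (inj j<i i≤t)

    -- A walk that returns to an inner vertex would enter it through one of the two edges
    -- that it has already used there.
    first-return : ∀ {t} → InjectiveTo t → ∀ i → i ≤ t → walk i ≡ walk (suc t) → i ≡ 0
    first-return inj zero _ _ = refl
    first-return {t} inj (suc i) i<t e
      with walk-neighbours i (subst (_~ walk t) (sym e) (~-sym (walk-~ t)))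
    ... | inj₁ wt≡wi = contradiction (injective-to inj ≤-refl (<⇒≤ i<t) wt≡wi) (>⇒≢ i<t)
    ... | inj₂ wt≡w2+i with m≤n⇒m<n∨m≡n i<t
    ...   | inj₂ refl = contradiction (sym wt≡w2+i) (~⇒≢ (walk-~ (suc i)) ∘ sym)
    ...   | inj₁ 2+i≤t with injective-to inj ≤-refl 2+i≤t wt≡w2+i
    ...     | refl = contradiction (sym e) (walk-turn (suc i))

    extend : ∀ {t} → InjectiveTo t → walk (suc t) ≢ walk 0 → InjectiveTo (suc t)
    extend inj ≢0 {i} i<j j≤1+t e with m≤n⇒m<n∨m≡n j≤1+t
    ... | inj₁ j≤t  = inj i<j (s≤s⁻¹ j≤t) e
    ... | inj₂ refl with first-return inj i (s≤s⁻¹ i<j) e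
    ...   | refl = ≢0 (sym e)

    -- The fuel and the length of the injective walk together stay at least `n`. When the fuel runs
    -- out, the walk would visit `suc t` distinct vertices with `n ≤ t`.
    find-return : ∀ fuel t → n ≤ fuel + t → InjectiveTo t →
      ∃ λ t → InjectiveTo t × walk (suc t) ≡ walk 0
    find-return zero t n≤t inj = contradiction
      (injective⇒≤ {f = λ (i : Fin (suc t)) → walk (toℕ i)}
        λ {i} {j} → toℕ-injective ∘ injective-to inj (s≤s⁻¹ (toℕ<n i)) (s≤s⁻¹ (toℕ<n j)))
      (<⇒≱ (s≤s n≤t))
    find-return (suc fuel) t n≤ inj with walk (suc t) Fin.≟ walk 0
    ... | yes e = t , inj , e
    ... | no ≢0 = find-return fuel (suc t) (subst (n ≤_) (sym (+-suc fuel t)) n≤) (extend inj ≢0)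

  -- `closed` makes the cycle a union of components. `reachable` expresses connection to `s` through
  -- predicates stable under adjacency, which avoids a notion of path.
  record Cycle (s : Fin n) : Set₁ where
    field
      k         : ℕ
      3≤k       : 3 ≤ k
      vertex    : Fin k → Fin n
      injective : ∀ {i j} → vertex i ≡ vertex j → i ≡ j
      adjacent  : ∀ i j → F (vertex i) (vertex j) ≡ C k i j
      closed    : ∀ i {v} → vertex i ~ v → ∃ λ j → vertex j ≡ v
      reachable : ∀ (P : Fin n → Set) → (∀ {u v} → P u → u ~ v → P v) → ∀ i → P (vertex i) → P s

  close : ∀ s {t} → let open Walk s in InjectiveTo t → walk (suc t) ≡ walk 0 → Cycle s
  close s {t} inj return = record
    { k         = suc t
    ; 3≤k       = s≤s 2≤t
    ; vertex    = walk ∘ toℕ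
    ; injective = λ {i} {j} → toℕ-injective ∘ injective-to inj (bound i) (bound j)
    ; adjacent  = λ i j → bool-ext
        (cycAdj-complete (suc t) (toℕ i) (toℕ j) ∘ forward (bound i) (bound j))
        (backward ∘ cycAdj-cases (suc t) (toℕ i) (toℕ j))
    ; closed    = λ i e → closed (toℕ i) (bound i) e
    ; reachable = λ P stable i → back P stable (toℕ i)
    }
    where
    open Walk s

    -- A return after one step would be a loop, and a return after two steps would reverse the first
    -- edge.
    2≤t : 2 ≤ t
    2≤t = go t return
      where
      go : ∀ t → walk (suc t) ≡ walk 0 → 2 ≤ t
      go zero          e = contradiction (sym e) (~⇒≢ (walk-~ 0))
      go (suc zero)    e = contradiction e (walk-turn 0)
      go (suc (suc _)) _ = s≤s (s≤s z≤n)

    bound : ∀ (i : Fin (suc t)) → toℕ i ≤ t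
    bound i = s≤s⁻¹ (toℕ<n i)

    last-~ : walk 0 ~ walk t
    last-~ = ~-sym (subst (walk t ~_) return (walk-~ t))

    start-neighbours : ∀ {z} → walk 0 ~ z → z ≡ walk 1 ⊎ z ≡ walk t
    start-neighbours = two-neighbours (walk-~ 0) last-~ (inj 2≤t ≤-refl)

    forward< : ∀ i j → i < j → j ≤ t → walk i ~ walk j → suc i ≡ j ⊎ (i ≡ 0 × suc j ≡ suc t)
    forward< zero j 0<j j≤t e with start-neighbours e
    ... | inj₁ e₁ = inj₁ (sym (injective-to inj j≤t (<⇒≤ 2≤t) e₁))
    ... | inj₂ e₂ = inj₂ (refl , cong suc (injective-to inj j≤t ≤-refl e₂))
    forward< (suc i) j i<j j≤t e with walk-neighbours i e
    ... | inj₁ e₁ = contradiction (sym e₁) (inj (<⇒≤ i<j) j≤t)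
    ... | inj₂ e₂ = inj₁ (sym (injective-to inj j≤t (≤-trans i<j j≤t) e₂))

    forward : ∀ {i j} → i ≤ t → j ≤ t → walk i ~ walk j →
      suc i ≡ j ⊎ suc j ≡ i ⊎ (i ≡ 0 × suc j ≡ suc t) ⊎ (j ≡ 0 × suc i ≡ suc t)
    forward {i} {j} i≤t j≤t e with <-cmp i j
    ... | tri< i<j _ _ = Sum.map₂ (inj₂ ∘ inj₁) (forward< i j i<j j≤t e)
    ... | tri≈ _ refl _ = contradiction refl (~⇒≢ e)
    ... | tri> _ _ j<i = inj₂ (Sum.map₂ inj₂ (forward< j i j<i i≤t (~-sym e)))

    backward : ∀ {i j} → suc i ≡ j ⊎ suc j ≡ i ⊎ (i ≡ 0 × suc j ≡ suc t) ⊎ (j ≡ 0 × suc i ≡ suc t) →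
      walk i ~ walk j
    backward {i} (inj₁ refl)                      = walk-~ i
    backward {_} {j} (inj₂ (inj₁ refl))           = ~-sym (walk-~ j)
    backward (inj₂ (inj₂ (inj₁ (refl , refl))))   = last-~
    backward (inj₂ (inj₂ (inj₂ (refl , refl))))   = ~-sym last-~

    at : ∀ {i v} → i ≤ t → v ≡ walk i → ∃ λ (j : Fin (suc t)) → walk (toℕ j) ≡ v
    at i≤t refl = fromℕ< (s≤s i≤t) , cong walk (toℕ-fromℕ< (s≤s i≤t))

    closed : ∀ i → i ≤ t → ∀ {v} → walk i ~ v → ∃ λ (j : Fin (suc t)) → walk (toℕ j) ≡ v
    closed zero i≤t e = [ at (<⇒≤ 2≤t) , at ≤-refl ]′ (start-neighbours e)
    closed (suc i) i<t e with walk-neighbours i e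
    ... | inj₁ v≡ = at (<⇒≤ i<t) v≡
    ... | inj₂ v≡ with m≤n⇒m<n∨m≡n i<t
    ...   | inj₁ 2+i≤t = at 2+i≤t v≡
    -- The successor of the last vertex is the starting point, which has index 0.
    ...   | inj₂ refl  = at z≤n (trans v≡ return)

    back : ∀ (P : Fin n → Set) → (∀ {u v} → P u → u ~ v → P v) → ∀ i → P (walk i) → P s
    back P stable zero    p = p
    back P stable (suc i) p = back P stable i (stable p (~-sym (walk-~ i)))

  cycle-through : ∀ s → Cycle s
  cycle-through s with Walk.find-return s n 0 (m≤m+n n 0) (λ { (s≤s _) () })
  ... | t , inj , return = close s inj return

  -- Collecting cycles until all vertices are covered

  record Part (ks : List ℕ) : Set where
    field
      vertex    : Vertex ks → Fin n
      injective : ∀ {x y} → vertex x ≡ vertex y → x ≡ y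
      adjacent  : ∀ x y → F (vertex x) (vertex y) ≡ cycles ks x y
      -- The image is a union of components; this keeps a cycle through an uncovered vertex entirely
      -- outside it.
      closed    : ∀ x {v} → vertex x ~ v → ∃ λ y → vertex y ≡ v

  covered? : ∀ {ks} (p : Part ks) v → Dec (∃ λ x → Part.vertex p x ≡ v)
  covered? {ks} p v = map′
    (λ (i , e) → Inverse.to (enumeration ks) i , e)
    (λ (x , e) → Inverse.from (enumeration ks) x ,
      trans (cong (Part.vertex p) (Inverse.strictlyInverseˡ (enumeration ks) x)) e)
    (any? λ i → Part.vertex p (Inverse.to (enumeration ks) i) Fin.≟ v)

  sum≤n : ∀ {ks} → Part ks → sum ks ≤ n
  sum≤n {ks} p = injective⇒≤ {f = Part.vertex p ∘ Inverse.to e}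
    λ {i} {j} eq → trans (sym (Inverse.strictlyInverseʳ e i))
      (trans (cong (Inverse.from e) (Part.injective p eq)) (Inverse.strictlyInverseʳ e j))
    where e = enumeration ks

  cons : ∀ {ks s} (p : Part ks) (c : Cycle s) → ¬ (∃ λ x → Part.vertex p x ≡ s) → Part (Cycle.k c ∷ ks)
  cons {ks} {s} p c s∉p = record
    { vertex    = vertex
    ; injective = λ
      { {inj₁ i} {inj₁ j} e → cong inj₁ (c.injective e)
      ; {inj₁ i} {inj₂ y} e → ⊥-elim (disjoint i (y , sym e))
      ; {inj₂ x} {inj₁ j} e → ⊥-elim (disjoint j (x , e))
      ; {inj₂ x} {inj₂ y} e → cong inj₂ (p.injective e) }
    ; adjacent  = λ
      { (inj₁ i) (inj₁ j) → c.adjacent i j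
      ; (inj₁ i) (inj₂ y) → trans (F-sym _ _) (separated y i)
      ; (inj₂ x) (inj₁ j) → separated x j
      ; (inj₂ x) (inj₂ y) → p.adjacent x y }
    ; closed    = λ
      { (inj₁ i) e → let (j , eq) = c.closed i e in inj₁ j , eq
      ; (inj₂ x) e → let (y , eq) = p.closed x e in inj₂ y , eq }
    }
    where
    module p = Part p
    module c = Cycle c

    vertex : Vertex (c.k ∷ ks) → Fin n
    vertex = [ c.vertex , p.vertex ]′

    -- Membership in the old part is stable under adjacency, so a shared vertex would pull `s` into
    -- that part.
    disjoint : ∀ i → ¬ (∃ λ x → p.vertex x ≡ c.vertex i)
    disjoint i h = s∉p (c.reachable (λ v → ∃ λ x → p.vertex x ≡ v)
      (λ { (x , refl) → p.closed x }) i h)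

    separated : ∀ x j → F (p.vertex x) (c.vertex j) ≡ false
    separated x j with F (p.vertex x) (c.vertex j) in e
    ... | false = refl
    ... | true  = ⊥-elim (disjoint j (p.closed x e))

  rearrange : ∀ {k ks ls} → Insertion k ks ls → Part (k ∷ ks) → Part ls
  rearrange i p = record
    { vertex    = vertex ∘ split i
    ; injective = λ {x} {y} e → trans (sym (merge-split i x))
        (trans (cong (merge i) (injective e)) (merge-split i y))
    ; adjacent  = λ x y → trans (adjacent (split i x) (split i y)) (split-adjacent i x y)
    ; closed    = λ x e → let (y , eq) = closed (split i x) e in
        merge i y , trans (cong vertex (split-merge i y)) eq
    }
    where open Part p

  Complete : Set
  Complete = ∃ λ ks → All (3 ≤_) ks × AllPairs _≤_ ks × CycleIso ks F

  -- Each round spends one unit of fuel and adds a cycle of at least one vertex, so the inequality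
  -- persists. Without fuel the part would have more than `n` vertices.
  complete : ∀ fuel ks → n < fuel + sum ks → All (3 ≤_) ks → AllPairs _≤_ ks → Part ks → Complete
  complete zero ks n< _ _ p = contradiction (sum≤n p) (<⇒≱ n<)
  complete (suc fuel) ks n< 3≤ sorted p with all? (covered? p)
  ... | yes cover = ks , 3≤ , sorted ,
    mk↔ₛ′ vertex (proj₁ ∘ cover) (proj₂ ∘ cover) (λ x → injective (proj₂ (cover (vertex x)))) , adjacent
    where open Part p
  ... | no ¬cover with ¬∀⟶∃¬ n _ (covered? p) ¬cover
  ...   | s , s∉p with insert-sorted (Cycle.k (cycle-through s)) sorted
  ...     | ls , i , sorted′ = complete fuel ls
    (≤-trans n< (≤-trans (≤-reflexive (sym (+-suc fuel (sum ks))))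
      (+-monoʳ-≤ fuel (≤-trans (+-monoˡ-≤ (sum ks) (≤-trans (s≤s z≤n) (Cycle.3≤k c)))
        (≤-reflexive (sym (insertion-sum i)))))))
    (insertion-all i (Cycle.3≤k c) 3≤) sorted′ (rearrange i (cons p c s∉p))
    where c = cycle-through s

  decomposition : Complete
  decomposition = complete (suc n) [] (s≤s (m≤m+n n 0)) [] [] record
    { vertex = λ () ; injective = λ { {()} } ; adjacent = λ () ; closed = λ () }

-- Non-triangulable graphs by exhaustive search

-- Composing the placement with the isomorphism deletes the same hull pairs, so the same diagonals
-- serve.
iso-triangulable : ∀ {n} (F H : Graph n) → Iso F H → PotentiallyTriangulable F → PotentiallyTriangulable H
iso-triangulable F H (f , f-adj) (π , boundary , D , len , diags , compat) =
  ↔-trans π f ,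
  (λ a b a<b bd → trans (same a b) (boundary a b a<b bd)) ,
  D , len , All.map (λ { (d , kept) → d , trans (same _ _) kept }) diags , compat
  where
  same : ∀ a b → KminusPlaced H (↔-trans π f) a b ≡ KminusPlaced F π a b
  same a b = cong (if_then false else true) (f-adj (Inverse.to π a) (Inverse.to π b))

module Search {n : ℕ} (H : Graph n) where

  Extends : ∀ {m} → Fin n → Vec (Fin n) m → Set
  Extends v []         = ⊤
  Extends v ws@(w ∷ _) = H v w ≡ false × VAll.All (v ≢_) ws

  extends? : ∀ {m} v (ws : Vec (Fin n) m) → Dec (Extends v ws)
  extends? v []         = yes tt
  extends? v ws@(w ∷ _) = (H v w Bool.≟ false) ×-dec VAll.all? (λ u → ¬? (v Fin.≟ u)) ws

  -- Paths in the complement of `H`, grown from the last vertex backwards. A placement whose hull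
  -- edges are all kept reads off such a path, so no other placements need to be examined.
  paths : ∀ m → List (Vec (Fin n) m)
  paths zero    = [] ∷ []
  paths (suc m) = concatMap (λ ws → map (_∷ ws) (filter (λ v → extends? v ws) (allFin n))) (paths m)

  tabulate∈paths : ∀ {m} (q : Fin m → Fin n) → Injective _≡_ _≡_ q →
    (∀ i j → suc (toℕ i) ≡ toℕ j → H (q i) (q j) ≡ false) → Vec.tabulate q ∈ paths m
  tabulate∈paths {zero}  q inj nonadj = here refl
  tabulate∈paths {suc m} q inj nonadj = ∈-concatMap⁺ _ (lose
    (tabulate∈paths (q ∘ suc) (Fin.suc-injective ∘ inj) (λ i j e → nonadj (suc i) (suc j) (cong suc e)))
    (∈-map⁺ (_∷ _) (∈-filter⁺ (λ v → extends? v _) (∈-allFin (q zero)) (extends q inj nonadj))))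
    where
    extends : ∀ {m} (q : Fin (suc m) → Fin n) → Injective _≡_ _≡_ q →
      (∀ i j → suc (toℕ i) ≡ toℕ j → H (q i) (q j) ≡ false) → Extends (q zero) (Vec.tabulate (q ∘ suc))
    extends {zero}  q inj nonadj = tt
    extends {suc m} q inj nonadj =
      nonadj zero (suc zero) refl , VAll.tabulate⁺ {f = q ∘ suc} (λ i → Fin.0≢1+n ∘ inj)

  Segment : Set
  Segment = Fin n × Fin n

  Compatible : Segment → Segment → Set
  Compatible d e = d ≢ e × ¬ Cross d e

  compatible? : ∀ d e → Dec (Compatible d e)
  compatible? d@(a , b) e@(a′ , b′) = ¬? (≡-dec Fin._≟_ Fin._≟_ d e) ×-dec ¬?
    (((toℕ a <? toℕ a′) ×-dec (toℕ a′ <? toℕ b) ×-dec (toℕ b <? toℕ b′)) ⊎-dec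
     ((toℕ a′ <? toℕ a) ×-dec (toℕ a <? toℕ b′) ×-dec (toℕ b′ <? toℕ b)))

  -- Backtracking search for `k` pairwise compatible segments: after each choice, only the segments
  -- compatible with it remain.
  Family : ℕ → List Segment → Set
  Family zero    ds = ⊤
  Family (suc k) ds = Any (λ d → Family k (filter (compatible? d) ds)) ds

  family? : ∀ k ds → Dec (Family k ds)
  family? zero    ds = yes tt
  family? (suc k) ds = Any.any? (λ d → family? k (filter (compatible? d) ds)) ds

  toFamily : ∀ D {ds} → All (_∈ ds) D → AllPairs Compatible D → Family (length D) ds
  toFamily []      _            _              = tt
  toFamily (d ∷ D) (d∈ ∷ D∈) (d~D ∷ pairs) = lose d∈ (toFamily D
    (All.zipWith (λ { (e∈ , d~e) → ∈-filter⁺ (compatible? d) e∈ d~e }) (D∈ , d~D)) pairs)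

  Candidate : Vec (Fin n) n → Segment → Set
  Candidate ws (a , b) = IsDiagonal n (a , b) × H (lookup ws a) (lookup ws b) ≡ false

  candidate? : ∀ ws d → Dec (Candidate ws d)
  candidate? ws (a , b) =
    ((toℕ a <? toℕ b) ×-dec ¬? ((suc (toℕ a) ≟ toℕ b) ⊎-dec ((toℕ a ≟ 0) ×-dec (suc (toℕ b) ≟ n))))
    ×-dec (H (lookup ws a) (lookup ws b) Bool.≟ false)

  candidates : Vec (Fin n) n → List Segment
  candidates ws = filter (candidate? ws) (cartesianProduct (allFin n) (allFin n))

  -- Completes a Hamiltonian path of the complement to a cycle. The ends are given by equations,
  -- since for a general `n` there may be no first or last position to name.
  Closed : Vec (Fin n) n → Set
  Closed ws = ∀ a b → toℕ a < toℕ b → toℕ a ≡ 0 → suc (toℕ b) ≡ n → H (lookup ws a) (lookup ws b) ≡ false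

  closed? : ∀ ws → Dec (Closed ws)
  closed? ws = all? λ a → all? λ b → (toℕ a <? toℕ b) →-dec ((toℕ a ≟ 0) →-dec
    ((suc (toℕ b) ≟ n) →-dec (H (lookup ws a) (lookup ws b) Bool.≟ false)))

  Refuted : Vec (Fin n) n → Set
  Refuted ws = Closed ws → ¬ Family (n ∸ 3) (candidates ws)

  refuted? : ∀ ws → Dec (Refuted ws)
  refuted? ws = closed? ws →-dec ¬? (family? (n ∸ 3) (candidates ws))

  -- The exhaustive search runs as evaluation of the implicit argument. A triangulated placement
  -- would yield a member of `paths n` together with a `Family` of its `n ∸ 3` diagonals, which that
  -- search has excluded.
  not-triangulable : {_ : True (All.all? refuted? (paths n))} → ¬ PotentiallyTriangulable H
  not-triangulable {ok} (π , boundary , D , len , diags , compat) =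
    All.lookup (toWitness ok) ws∈paths
      (λ a b a<b a≡0 1+b≡n → kept (boundary a b a<b (inj₂ (a≡0 , 1+b≡n))))
      (subst (λ k → Family k (candidates ws)) len (toFamily D
        (All.map (λ { (diag , e) → ∈-filter⁺ (candidate? ws)
          (∈-cartesianProduct⁺ (∈-allFin _) (∈-allFin _)) (diag , kept e) }) diags) compat))
    where
    p : Fin n → Fin n
    p = Inverse.to π

    ws : Vec (Fin n) n
    ws = Vec.tabulate p

    nonadjacent : ∀ {a b} → KminusPlaced H π a b ≡ true → H (p a) (p b) ≡ false
    nonadjacent {a} {b} e with H (p a) (p b)
    ... | false = refl

    kept : ∀ {a b} → KminusPlaced H π a b ≡ true → H (lookup ws a) (lookup ws b) ≡ false
    kept {a} {b} e rewrite Vec.lookup∘tabulate p a | Vec.lookup∘tabulate p b = nonadjacent e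

    ws∈paths : ws ∈ paths n
    ws∈paths = tabulate∈paths p (λ {x} {y} e → trans (sym (Inverse.strictlyInverseʳ π x))
        (trans (cong (Inverse.from π) e) (Inverse.strictlyInverseʳ π y)))
      (λ i j 1+i≡j → nonadjacent (boundary i j (≤-reflexive 1+i≡j) (inj₁ 1+i≡j)))

-- Transport along isomorphisms and the equivalence

iso-refutes : ∀ {m n} (F : Graph n) (H : Graph m) →
  ¬ PotentiallyTriangulable H → Iso F H → ¬ PotentiallyTriangulable F
iso-refutes F H ¬H iso@(f , _) pt with ↔⇒≡ f
... | refl = ¬H (iso-triangulable F H iso pt)

-- Evaluation checks that `H`, read through `enumeration`, agrees with the abstract union of cycles;
-- the isomorphism with `F` then follows by composition.
iso : ∀ {ks n} {F : Graph n} (H : Graph (sum ks)) → let e = Inverse.from (enumeration ks) in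
  {_ : True (allVertices? ks λ x → allVertices? ks λ y → H (e x) (e y) Bool.≟ cycles ks x y)} →
  CycleIso ks F → Iso F H
iso {ks} {F = F} H {ok} (f , adjacent) = ↔-trans (↔-sym f) (↔-sym (enumeration ks)) , λ a b →
  trans (toWitness ok (from a) (from b))
    (trans (sym (adjacent (from a) (from b)))
      (cong₂ F (Inverse.strictlyInverseˡ f a) (Inverse.strictlyInverseˡ f b)))
  where open Inverse f using (from)

exceptional-iso : ∀ {ks n} {F : Graph n} → Exceptional ks → CycleIso ks F →
  Iso F (C 3) ⊎ Iso F (C 4) ⊎ Iso F (C 5) ⊎ Iso F (C 6) ⊎ Iso F (C 3 ∪ᴳ C 3) ⊎ Iso F (C 3 ∪ᴳ C 4)
exceptional-iso c₃  f = inj₁ (iso (C 3) f)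
exceptional-iso c₄  f = inj₂ (inj₁ (iso (C 4) f))
exceptional-iso c₅  f = inj₂ (inj₂ (inj₁ (iso (C 5) f)))
exceptional-iso c₆  f = inj₂ (inj₂ (inj₂ (inj₁ (iso (C 6) f))))
exceptional-iso c₃₃ f = inj₂ (inj₂ (inj₂ (inj₂ (inj₁ (iso (C 3 ∪ᴳ C 3) f)))))
exceptional-iso c₃₄ f = inj₂ (inj₂ (inj₂ (inj₂ (inj₂ (iso (C 3 ∪ᴳ C 4) f)))))

spread-iso : ∀ {ks n} {F : Graph n} → CycleIso ks F → Spread (cycles ks) (sum ks) → Spread F n
spread-iso {ks} {n} {F} (f , adjacent) G = record
  { label     = label ∘ from
  ; injective = λ {a} {b} e → trans (sym (strictlyInverseˡ a))
      (trans (cong to (injective e)) (strictlyInverseˡ b))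
  -- The labels are bounded by `sum ks`, which equals `n` because of the bijection.
  ; bounded   = λ a → subst (label (from a) <_) (↔⇒≡ (↔-trans (enumeration ks) f)) (bounded (from a))
  ; far       = λ a b e → far (from a) (from b) (trans (sym (adjacent (from a) (from b)))
      (trans (cong₂ F (strictlyInverseˡ a) (strictlyInverseˡ b)) e))
  }
  where
  open Spread G
  open Inverse f using (to; from; strictlyInverseˡ)

spread-empty : Spread (cycles []) 0
spread-empty = record
  { label = λ () ; injective = λ { {()} } ; bounded = λ () ; far = λ () }

theorem5 : (n : ℕ) (F : Graph n) → Symmetric F → Loopless F → TwoRegular F →
    (PotentiallyTriangulable F ⇔
    (¬ (Iso F (C 3) ⊎ Iso F (C 4) ⊎ Iso F (C 5) ⊎ Iso F (C 6) ⊎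
    Iso F (C 3 ∪ᴳ C 3) ⊎ Iso F (C 3 ∪ᴳ C 4))))
theorem5 n F F-sym F-irrefl F-regular = mk⇔ necessary sufficient
  where
  necessary : PotentiallyTriangulable F → ¬ _
  necessary pt (inj₁ i)                             = iso-refutes F (C 3) (Search.not-triangulable (C 3)) i pt
  necessary pt (inj₂ (inj₁ i))                      = iso-refutes F (C 4) (Search.not-triangulable (C 4)) i pt
  necessary pt (inj₂ (inj₂ (inj₁ i)))               = iso-refutes F (C 5) (Search.not-triangulable (C 5)) i pt
  necessary pt (inj₂ (inj₂ (inj₂ (inj₁ i))))        = iso-refutes F (C 6) (Search.not-triangulable (C 6)) i pt
  necessary pt (inj₂ (inj₂ (inj₂ (inj₂ (inj₁ i))))) =
    iso-refutes F (C 3 ∪ᴳ C 3) (Search.not-triangulable (C 3 ∪ᴳ C 3)) i pt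
  necessary pt (inj₂ (inj₂ (inj₂ (inj₂ (inj₂ i))))) =
    iso-refutes F (C 3 ∪ᴳ C 4) (Search.not-triangulable (C 3 ∪ᴳ C 4)) i pt

  sufficient : ¬ _ → PotentiallyTriangulable F
  sufficient ¬exceptional with Decomposition.decomposition F F-sym F-irrefl F-regular
  ... | ks , 3≤ks , sorted , f with classify ks 3≤ks sorted
  -- Without cycles `F` has no vertices, and the required number of diagonals `n ∸ 3` is 0.
  ...   | inj₁ refl           = Zigzag.potentiallyTriangulable F (spread-iso f spread-empty)
  ...   | inj₂ (inj₁ e)       = contradiction (exceptional-iso e f) ¬exceptional
  ...   | inj₂ (inj₂ (_ , G)) = Zigzag.potentiallyTriangulable F (spread-iso f G)
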